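{- For every integer $k\ge 2$ and every positive integer $n$, \[ \mathrm{ex}_3\big(n, C^{(3)}_{2k+1}\big)\le t_{2k+1}(n)+4\,\mathrm{ex}(n,C_{2k})+12\,\mathrm{ex}^{\mathrm{lin}}_3\big(n, C^{(3)}_{2k+1}\big). \]
   Context: A 3-uniform hypergraph is a set of 3-element subsets (hyperedges) of a vertex set. A Berge cycle of length $m$ in a hypergraph is a family of $m$ distinct hyperedges $H_0,\dots,H_{m-1}$ for which there exist distinct vertices $v_0,\dots,v_{m-1}$ with $\{v_i,v_{i+1}\}\subset H_i$ for $0\le i\le m-1$ (indices mod $m$). $C^{(3)}_m$ denotes the family of 3-uniform Berge cycles of length $m$; a hypergraph is $C^{(3)}_m$-free if it contains no Berge cycle of length $m$. A hypergraph is linear if any two distinct hyperedges share at most one vertex. $\mathrm{ex}_3(n,C^{(3)}_m)$ (resp. $\mathrm{ex}^{\mathrm{lin}}_3(n,C^{(3)}_m)$) is the maximum number of hyperedges in a 3-uniform (resp. 3-uniform linear) hypergraph on $n$ vertices with no Berge cycle of length $m$. $\mathrm{ex}(n,C_{2k})$ is the maximum number of edges of a simple graph on $n$ vertices with no cycle of length $2k$. $t_\ell(n)$ is the maximum number of triangles in a simple graph on $n$ vertices containing no cycle of length $\ell$. -}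

module Defs where

open import Data.Bool.Properties using () renaming (_≟_ to _≟ᵇ_)
open import Data.Fin using (Fin; toℕ; finToFun; funToFin)
open import Data.Fin.Properties
  using (nonZeroIndex; any?; all?; finToFun-funToFin) renaming (_≟_ to _≟ᶠ_)
open import Data.Fin.Subset using (Subset; inside; outside; _∈_; _∩_; _∪_; ⁅_⁆; ∣_∣)
open import Data.Fin.Subset.Properties using (_∈?_)
open import Data.List using (List; []; _∷_; _++_; map; filter; length; lookup)
open import Data.List.Extrema.Nat using (argmax; argmax-all; f[xs]≤f[argmax])
open import Data.List.Membership.Propositional using () renaming (_∈_ to _∈ₗ_)
open import Data.List.Membership.Propositional.Properties
  using (∈-map⁺; ∈-map⁻; ∈-++⁺ˡ; ∈-++⁺ʳ; ∈-filter⁺; ∈-filter⁻; ∈-lookup)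
open import Data.List.Membership.Propositional.Properties.WithK using (unique∧set⇒bag)
open import Data.List.Properties using (filter-≐)
open import Data.List.Relation.Binary.BagAndSetEquality using (∼bag⇒↭)
open import Data.List.Relation.Binary.Permutation.Propositional.Properties using (↭-length)
open import Data.List.Relation.Unary.All as All using (All; []; _∷_)
open import Data.List.Relation.Unary.All.Properties using (all-filter)
open import Data.List.Relation.Unary.AllPairs using ([]; _∷_)
open import Data.List.Relation.Unary.Any using (here; there; index)
open import Data.List.Relation.Unary.Any.Properties using (lookup-index)
open import Data.List.Relation.Unary.Unique.Propositional using (Unique)
import Data.List.Relation.Unary.Unique.Propositional.Properties as Unique
open import Data.Nat using (ℕ; zero; suc; s≤s; _≤_; _<_; _≤?_; _<?_; _≟_)
open import Data.Nat.DivMod using (_mod_)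
open import Data.Product using (∃; ∃-syntax; _×_; _,_; proj₁; proj₂)
open import Data.Vec using ([]; _∷_)
open import Data.Vec.Properties using (≡-dec; ∷-injectiveʳ)
open import Function using (_∘_; mk⇔)
open import Function.Definitions using (Injective)
open import Relation.Binary.Definitions using (DecidableEquality)
open import Relation.Binary.PropositionalEquality
  using (_≡_; _≢_; refl; sym; trans; cong; subst; subst₂)
open import Relation.Nullary using (¬_; Dec; yes; no)
open import Relation.Nullary.Decidable using (map′; _×-dec_; _→-dec_; ¬?)
open import Relation.Unary using (Decidable)

private
  variable
    r n m : ℕ

-- An r-uniform hypergraph is a set of r-element subsets of Fin n; the list
-- only enumerates it, and its order is irrelevant to everything below.
record Hypergraph (r n : ℕ) : Set where
  field
    edges   : List (Subset n)
    unique  : Unique edges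
    uniform : All (λ e → ∣ e ∣ ≡ r) edges

  size : ℕ
  size = length edges

open Hypergraph public using (edges; unique; uniform; size)

-- The edge joining u and w is the 2-element subset ⁅ u ⁆ ∪ ⁅ w ⁆.
Graph : ℕ → Set
Graph = Hypergraph 2

Adjacent : Graph n → Fin n → Fin n → Set
Adjacent G u w = (⁅ u ⁆ ∪ ⁅ w ⁆) ∈ₗ edges G

Linear : Hypergraph r n → Set
Linear H = ∀ {e f} → e ∈ₗ edges H → f ∈ₗ edges H → e ≢ f → ∣ e ∩ f ∣ ≤ 1

IsTriangle : Graph n → Subset n → Set
IsTriangle G T =
  ∣ T ∣ ≡ 3 × (∀ {u w} → u ∈ T → w ∈ T → u ≢ w → Adjacent G u w)

next : Fin m → Fin m
next {m} i = _mod_ (suc (toℕ i)) m {{nonZeroIndex i}}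

record Cycle (m : ℕ) (G : Graph n) : Set where
  field
    3≤m        : 3 ≤ m
    v          : Fin m → Fin n
    v-distinct : Injective _≡_ _≡_ v
    v-adjacent : ∀ i → Adjacent G (v i) (v (next i))

-- Positivity of m only excludes the empty family of hyperedges.
record BergeCycle (m : ℕ) (H : Hypergraph r n) : Set where
  field
    0<m        : 0 < m
    h          : Fin m → Subset n
    h-edge     : ∀ i → h i ∈ₗ edges H
    h-distinct : Injective _≡_ _≡_ h
    v          : Fin m → Fin n
    v-distinct : Injective _≡_ _≡_ v
    v∈h        : ∀ i → v i ∈ h i
    v-next∈h   : ∀ i → v (next i) ∈ h i

allSubsets : ∀ n → List (Subset n)
allSubsets zero    = [] ∷ []
allSubsets (suc n) = map (inside ∷_) (allSubsets n) ++ map (outside ∷_) (allSubsets n)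

∈-allSubsets : (s : Subset n) → s ∈ₗ allSubsets n
∈-allSubsets []            = here refl
∈-allSubsets (inside  ∷ s) = ∈-++⁺ˡ (∈-map⁺ (inside ∷_) (∈-allSubsets s))
∈-allSubsets {suc n} (outside ∷ s) =
  ∈-++⁺ʳ (map (inside ∷_) (allSubsets n)) (∈-map⁺ (outside ∷_) (∈-allSubsets s))

allSubsets-unique : ∀ n → Unique (allSubsets n)
allSubsets-unique zero    = [] ∷ []
allSubsets-unique (suc n) = Unique.++⁺
  (Unique.map⁺ ∷-injectiveʳ (allSubsets-unique n))
  (Unique.map⁺ ∷-injectiveʳ (allSubsets-unique n))
  disjoint
  where
  disjoint : ∀ {s} → ¬ (s ∈ₗ map (inside ∷_) (allSubsets n) ×
                        s ∈ₗ map (outside ∷_) (allSubsets n))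
  disjoint (p , q) with ∈-map⁻ (inside ∷_) p | ∈-map⁻ (outside ∷_) q
  ... | _ , _ , refl | _ , _ , ()

infix 4 _≟ˢ_
_≟ˢ_ : DecidableEquality (Subset n)
_≟ˢ_ = ≡-dec _≟ᵇ_

infix 4 _∈ₗ?_
_∈ₗ?_ : (s : Subset n) (ss : List (Subset n)) → Dec (s ∈ₗ ss)
_∈ₗ?_ = DecMem._∈?_
  where import Data.List.Membership.DecPropositional _≟ˢ_ as DecMem

isTriangle? : (G : Graph n) → Decidable (IsTriangle G)
isTriangle? G T = (∣ T ∣ ≟ 3) ×-dec
  map′ (λ p {u} {w} → p u w) (λ p u w → p {u} {w})
    (all? λ u → all? λ w → (u ∈? T) →-dec (w ∈? T) →-dec
      ¬? (u ≟ᶠ w) →-dec ((⁅ u ⁆ ∪ ⁅ w ⁆) ∈ₗ? edges G))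

triangleCount : Graph n → ℕ
triangleCount {n} G = length (filter (isTriangle? G) (allSubsets n))

record Maximum {A : Set} (P : A → Set) (w : A → ℕ) : Set where
  field
    value    : ℕ
    attained : ∃[ a ] P a × w a ≡ value
    bound    : ∀ a → P a → w a ≤ value

infix 4 _⊑_
_⊑_ : Hypergraph r n → Hypergraph r n → Set
H ⊑ K = ∀ {e} → e ∈ₗ edges H → e ∈ₗ edges K

size-cong : (H K : Hypergraph r n) → H ⊑ K → K ⊑ H → size H ≡ size K
size-cong H K p q =
  ↭-length (∼bag⇒↭ (unique∧set⇒bag (unique H) (unique K) (mk⇔ p q)))

triangleCount-cong : (G K : Graph n) → G ⊑ K → K ⊑ G →
                     triangleCount G ≡ triangleCount K
triangleCount-cong {n} G K p q = cong length (filter-≐ (isTriangle? G) (isTriangle? K)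
  ( (λ (c , t) → c , λ u w u≢w → p (t u w u≢w))
  , (λ (c , t) → c , λ u w u≢w → q (t u w u≢w)) )
  (allSubsets n))

private
  empty : ∀ r n → Hypergraph r n
  empty r n = record { edges = [] ; unique = [] ; uniform = [] }

  uniformSubsets : ∀ r n → List (Subset n)
  uniformSubsets r n = filter (λ s → ∣ s ∣ ≟ r) (allSubsets n)

  fromList : ∀ r → List (Subset n) → Hypergraph r n
  fromList {n} r ss = record
    { edges   = filter (_∈ₗ? ss) (uniformSubsets r n)
    ; unique  = Unique.filter⁺ (_∈ₗ? ss) (Unique.filter⁺ _ (allSubsets-unique n))
    ; uniform = All.tabulate λ e∈ → All.lookup (all-filter (λ s → ∣ s ∣ ≟ r) (allSubsets n))
                                      (proj₁ (∈-filter⁻ (_∈ₗ? ss) e∈))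
    }

  sublists : {A : Set} → List A → List (List A)
  sublists []       = [] ∷ []
  sublists (x ∷ xs) = map (x ∷_) (sublists xs) ++ sublists xs

  filter∈sublists : {A : Set} {P : A → Set} (P? : Decidable P) (xs : List A) →
                    filter P? xs ∈ₗ sublists xs
  filter∈sublists P? []       = here refl
  filter∈sublists P? (x ∷ xs) with P? x
  ... | yes _ = ∈-++⁺ˡ (∈-map⁺ (x ∷_) (filter∈sublists P? xs))
  ... | no  _ = ∈-++⁺ʳ (map (x ∷_) (sublists xs)) (filter∈sublists P? xs)

  hypergraphs : ∀ r n → List (Hypergraph r n)
  hypergraphs r n = map (fromList r) (sublists (uniformSubsets r n))

  -- Hypergraphs with the same hyperedges in another order need not be equal,
  -- so the finite list is complete only up to mutual inclusion.
  represent : (H : Hypergraph r n) →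
              ∃[ K ] K ∈ₗ hypergraphs r n × H ⊑ K × K ⊑ H
  represent {r} {n} H =
    fromList r ss , ∈-map⁺ (fromList r) (filter∈sublists (_∈ₗ? edges H) (uniformSubsets r n))
    , (λ e∈ → let e∈U = ∈-filter⁺ _ (∈-allSubsets _) (All.lookup (uniform H) e∈) in
              ∈-filter⁺ (_∈ₗ? ss) e∈U (∈-filter⁺ (_∈ₗ? edges H) e∈U e∈))
    , (λ e∈ → proj₂ (∈-filter⁻ (_∈ₗ? edges H) {xs = uniformSubsets r n}
                (proj₂ (∈-filter⁻ (_∈ₗ? ss) {xs = uniformSubsets r n} e∈))))
    where
    ss : List (Subset n)
    ss = filter (_∈ₗ? edges H) (uniformSubsets r n)

maximum : {P : Hypergraph r n → Set} {w : Hypergraph r n → ℕ} →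
          Decidable P →
          (∀ {H K} → H ⊑ K → K ⊑ H → P H → P K) →
          (∀ H K → H ⊑ K → K ⊑ H → w H ≡ w K) →
          P (empty r n) →
          Maximum P w
maximum {r} {n} {P} {w} P? P-resp w-resp P∅ = record
  { value    = w best
  ; attained = best , argmax-all w P∅ (all-filter P? (hypergraphs r n)) , refl
  ; bound    = bound
  }
  where
  candidates = filter P? (hypergraphs r n)
  best       = argmax w (empty r n) candidates

  bound : ∀ H → P H → w H ≤ w best
  bound H PH with represent H
  ... | K , K∈ , H⊑K , K⊑H =
    subst (_≤ w best) (sym (w-resp H K H⊑K K⊑H))
      (All.lookup (f[xs]≤f[argmax] (empty r n) candidates)
        (∈-filter⁺ P? K∈ (P-resp H⊑K K⊑H PH)))

private
  injective? : ∀ {A : Set} → DecidableEquality A →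
               (f : Fin m → A) → Dec (Injective _≡_ _≡_ f)
  injective? _≟ₐ_ f = map′ (λ p {i} {j} → p i j) (λ p i j → p {i} {j})
    (all? λ i → all? λ j → (f i ≟ₐ f j) →-dec (i ≟ᶠ j))

  anyFun? : ∀ {a b} {P : (Fin a → Fin b) → Set} →
            (∀ {f g} → (∀ i → f i ≡ g i) → P f → P g) →
            Decidable P → Dec (∃ P)
  anyFun? resp P? = map′
    (λ (c , p) → finToFun c , p)
    (λ (f , p) → funToFin f , resp (λ i → sym (finToFun-funToFin f i)) p)
    (any? (P? ∘ finToFun))

  injective-resp : ∀ {A : Set} {f g : Fin m → A} → (∀ i → f i ≡ g i) →
                   Injective _≡_ _≡_ f → Injective _≡_ _≡_ g
  injective-resp eq inj {i} {j} gi≡gj = inj (trans (eq i) (trans gi≡gj (sym (eq j))))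

cycle? : ∀ m (G : Graph n) → Dec (Cycle m G)
cycle? {n} m G = map′ to from
  ((3 ≤? m) ×-dec anyFun?
    (λ eq (inj , adj) → injective-resp eq inj ,
      λ i → subst₂ (Adjacent G) (eq i) (eq (next i)) (adj i))
    (λ v → injective? _≟ᶠ_ v ×-dec
           all? λ i → (⁅ v i ⁆ ∪ ⁅ v (next i) ⁆) ∈ₗ? edges G))
  where
  Encoding : Set
  Encoding = 3 ≤ m × ∃ λ (v : Fin m → Fin n) →
    Injective _≡_ _≡_ v × (∀ i → Adjacent G (v i) (v (next i)))

  to : Encoding → Cycle m G
  to (m≥ , v , inj , adj) = record
    { 3≤m = m≥ ; v = v ; v-distinct = inj ; v-adjacent = adj }

  from : Cycle m G → Encoding
  from c = 3≤m , v , v-distinct , v-adjacent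
    where open Cycle c

bergeCycle? : ∀ m (H : Hypergraph r n) → Dec (BergeCycle m H)
bergeCycle? {n = n} m H = map′ to from
  ((0 <? m) ×-dec anyFun?
    (λ eq (inj , rest) →
      injective-resp (λ i → cong (lookup E) (eq i)) inj ,
      let v , injᵥ , p , q = rest in
      v , injᵥ , (λ i → subst (λ x → v i ∈ lookup E x) (eq i) (p i))
               , (λ i → subst (λ x → v (next i) ∈ lookup E x) (eq i) (q i)))
    (λ h → injective? _≟ˢ_ (lookup E ∘ h) ×-dec anyFun?
      (λ eq (inj , p , q) → injective-resp eq inj
        , (λ i → subst (_∈ lookup E (h i)) (eq i) (p i))
        , (λ i → subst (_∈ lookup E (h i)) (eq (next i)) (q i)))
      (λ v → injective? _≟ᶠ_ v ×-dec
             (all? λ i → v i ∈? lookup E (h i)) ×-dec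
             (all? λ i → v (next i) ∈? lookup E (h i)))))
  where
  E = edges H

  Encoding : Set
  Encoding = 0 < m × ∃ λ (h : Fin m → Fin (length E)) →
    Injective _≡_ _≡_ (lookup E ∘ h) × ∃ λ (v : Fin m → Fin n) →
      Injective _≡_ _≡_ v × (∀ i → v i ∈ lookup E (h i))
                          × (∀ i → v (next i) ∈ lookup E (h i))

  to : Encoding → BergeCycle m H
  to (m> , h , injₕ , v , injᵥ , p , q) = record
    { 0<m = m> ; h = lookup E ∘ h ; h-edge = λ i → ∈-lookup (h i) ; h-distinct = injₕ
    ; v = v ; v-distinct = injᵥ ; v∈h = p ; v-next∈h = q }

  from : BergeCycle m H → Encoding
  from c = 0<m , (λ i → index (h-edge i)) , injective-resp eq h-distinct
    , v , v-distinct
    , (λ i → subst (v i ∈_) (eq i) (v∈h i))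
    , (λ i → subst (v (next i) ∈_) (eq i) (v-next∈h i))
    where
    open BergeCycle c
    eq : ∀ i → h i ≡ lookup E (index (h-edge i))
    eq i = lookup-index (h-edge i)

linear? : (H : Hypergraph r n) → Dec (Linear H)
linear? H = map′
  (λ p e∈ f∈ → All.lookup (All.lookup p e∈) f∈)
  (λ lin → All.tabulate λ e∈ → All.tabulate λ f∈ → lin e∈ f∈)
  (All.all? (λ e → All.all? (λ f → ¬? (e ≟ˢ f) →-dec (∣ e ∩ f ∣ ≤? 1)) (edges H)) (edges H))

private
  cycle-mono : {G K : Graph n} → G ⊑ K → Cycle m G → Cycle m K
  cycle-mono p c = record
    { 3≤m = 3≤m ; v = v ; v-distinct = v-distinct ; v-adjacent = p ∘ v-adjacent }
    where open Cycle c

  bergeCycle-mono : {H K : Hypergraph r n} → H ⊑ K → BergeCycle m H → BergeCycle m K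
  bergeCycle-mono p c = record
    { 0<m = 0<m ; h = h ; h-edge = p ∘ h-edge ; h-distinct = h-distinct
    ; v = v ; v-distinct = v-distinct ; v∈h = v∈h ; v-next∈h = v-next∈h }
    where open BergeCycle c

  empty-cycle-free : ¬ Cycle m (empty 2 n)
  empty-cycle-free c with Cycle.3≤m c | Cycle.v-adjacent c
  ... | s≤s _ | adj with adj Fin.zero
  ...   | ()

  empty-bergeCycle-free : ¬ BergeCycle m (empty r n)
  empty-bergeCycle-free c with BergeCycle.0<m c | BergeCycle.h-edge c
  ... | s≤s _ | edge with edge Fin.zero
  ...   | ()

exMaximum : ∀ n m → Maximum {Graph n} (λ G → ¬ Cycle m G) size
exMaximum n m = maximum (λ G → ¬? (cycle? m G))
  (λ _ q free → free ∘ cycle-mono q) size-cong empty-cycle-free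

tMaximum : ∀ ℓ n → Maximum {Graph n} (λ G → ¬ Cycle ℓ G) triangleCount
tMaximum ℓ n = maximum (λ G → ¬? (cycle? ℓ G))
  (λ _ q free → free ∘ cycle-mono q) triangleCount-cong empty-cycle-free

ex₃Maximum : ∀ n m → Maximum {Hypergraph 3 n} (λ H → ¬ BergeCycle m H) size
ex₃Maximum n m = maximum (λ H → ¬? (bergeCycle? m H))
  (λ _ q free → free ∘ bergeCycle-mono q) size-cong empty-bergeCycle-free

ex₃ˡⁱⁿMaximum : ∀ n m →
  Maximum {Hypergraph 3 n} (λ H → Linear H × ¬ BergeCycle m H) size
ex₃ˡⁱⁿMaximum n m = maximum (λ H → linear? H ×-dec ¬? (bergeCycle? m H))
  (λ _ q (lin , free) → (λ e∈ f∈ → lin (q e∈) (q f∈)) , free ∘ bergeCycle-mono q)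
  size-cong ((λ ()) , empty-bergeCycle-free)

ex : ℕ → ℕ → ℕ
ex n m = Maximum.value (exMaximum n m)

t : ℕ → ℕ → ℕ
t ℓ n = Maximum.value (tMaximum ℓ n)

ex₃ : ℕ → ℕ → ℕ
ex₃ n m = Maximum.value (ex₃Maximum n m)

ex₃ˡⁱⁿ : ℕ → ℕ → ℕ
ex₃ˡⁱⁿ n m = Maximum.value (ex₃ˡⁱⁿMaximum n m)

-- Call a pair of vertices light if at most one edge contains it and heavy if at least
-- three do. The edges split into three kinds.
-- (1) No light pair: such edges are triangles of the graph of non-light pairs, whose
--     (2k+1)-cycles lift to Berge cycles.
-- (2) No heavy pair: each edge shares a pair with boundedly many edges, so a greedily
--     chosen linear subfamily has at least a twelfth of the edges.
-- (3) A light pair ab and a heavy pair ac: for some two-colouring of the vertices at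
--     least a quarter of these edges have a and b of one colour and c of the other. The
--     corresponding pairs ab form a graph in which a 2k-cycle could be lengthened to a
--     Berge (2k+1)-cycle by a detour through one of the vertices c.
module Submission where

open import Defs
open import Data.Bool using (Bool; true; false; not; if_then_else_)
open import Data.Bool.Properties using () renaming (_≟_ to _≟ᵇ_)
open import Data.Fin using (Fin; zero; suc; toℕ; fromℕ; inject₁)
open import Data.Fin.Induction using (<-weakInduction)
open import Data.Fin.Properties
  using (any?; fromℕ≢inject₁; toℕ-injective; toℕ-fromℕ; toℕ-fromℕ<; toℕ-inject₁; toℕ<n;
         suc-injective; 0≢1+n)
  renaming (_≟_ to _≟ᶠ_)
open import Data.Fin.Relation.Unary.Top using (view; ‵fromℕ; ‵inject₁)
open import Data.Fin.Subset
  using (Subset; inside; outside; _∈_; _⊆_; _∩_; _∪_; ⁅_⁆; ∣_∣)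
open import Data.Fin.Subset.Properties
  using (_∈?_; _⊆?_; ⊆-antisym; x∈⁅x⁆; x∈⁅y⁆⇒x≡y; x∈p∪q⁺; x∈p∪q⁻; x∈p∩q⁻; ∪-comm;
         ∩-comm; ∩-idem; x∈p∧x≢y⇒x∈p-y; x∈p⇒∣p-x∣<∣p∣)
open import Data.List using (List; []; _∷_; _++_; map; filter; length; concatMap)
open import Data.List.Membership.Propositional
  using (find; lose) renaming (_∈_ to _∈ₗ_; _∉_ to _∉ₗ_)
open import Data.List.Membership.Propositional.Properties
  using (∈-map⁻; ∈-filter⁺; ∈-filter⁻; ∈-concatMap⁺)
open import Data.List.Properties using (length-++; length-map; filter-notAll)
open import Data.List.Relation.Binary.Subset.Propositional using () renaming (_⊆_ to _⊆ₗ_)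
open import Data.List.Relation.Unary.All as All using (All; []; _∷_)
import Data.List.Relation.Unary.All.Properties as All
open import Data.List.Relation.Unary.AllPairs as AllPairs using (AllPairs; []; _∷_)
import Data.List.Relation.Unary.AllPairs.Properties as AllPairs
open import Data.List.Relation.Unary.Any as Any using (Any; here; there)
open import Data.List.Relation.Unary.Unique.Propositional using (Unique)
import Data.List.Relation.Unary.Unique.Propositional.Properties as Unique
open import Data.Nat
  using (ℕ; zero; suc; _+_; _*_; _≤_; _<_; _≤?_; _≟_; z≤n; s≤s)
open import Data.Nat.DivMod using (_%_; n%n≡0; m<n⇒m%n≡m)
open import Data.Nat.Properties
  using (≤-reflexive; ≤-trans; ≰⇒>; <⇒≱; ≮⇒≥; 1+n≰n; +-mono-≤; *-monoʳ-≤; +-comm; +-assoc; +-suc;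
         *-suc; <⇒≢; n≤1+n; +-mono-<; *-zeroʳ; *-distribˡ-+; ≤-antisym; module ≤-Reasoning)
open import Data.Nat.Solver using (module +-*-Solver)
open import Data.Product using (∃; ∃-syntax; _×_; _,_; proj₁; proj₂)
open import Data.Sum using (_⊎_; inj₁; inj₂; [_,_]′)
open import Data.Vec using ([]; _∷_; lookup; updateAt; here; there)
open import Data.Vec.Properties using (lookup∘updateAt; lookup∘updateAt′)
open import Function using (_∘_; id)
open import Function.Definitions using (Injective)
open import Relation.Binary.Definitions using (DecidableEquality)
open import Relation.Binary.PropositionalEquality
open import Relation.Nullary using (¬_; Dec; yes; no; does; contradiction)
open import Relation.Nullary.Decidable using (_×-dec_; ¬?; decidable-stable)
open import Relation.Unary using (Decidable)

private
  variable
    A B : Set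
    r n m : ℕ

-- Counting in lists and subsets

length-filter-split : {P : A → Set} (P? : Decidable P) (xs : List A) →
                      length xs ≡ length (filter P? xs) + length (filter (¬? ∘ P?) xs)
length-filter-split P? []       = refl
length-filter-split P? (x ∷ xs) with P? x
... | yes _ = cong suc (length-filter-split P? xs)
... | no  _ = trans (cong suc (length-filter-split P? xs)) (sym (+-suc _ _))

length-concatMap-≤ : ∀ {k} (f : A → List B) {xs : List A} → All (λ x → length (f x) ≤ k) xs →
                     length (concatMap f xs) ≤ k * length xs
length-concatMap-≤ f [] = z≤n
length-concatMap-≤ {k = k} f {x ∷ xs} (fx≤k ∷ fxs≤k) = begin
  length (f x ++ concatMap f xs)         ≡⟨ length-++ (f x) ⟩
  length (f x) + length (concatMap f xs) ≤⟨ +-mono-≤ fx≤k (length-concatMap-≤ f fxs≤k) ⟩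
  k + k * length xs                      ≡⟨ *-suc k (length xs) ⟨
  k * suc (length xs)                    ∎
  where open ≤-Reasoning

AllPairs-lookup : {R : A → A → Set} → (∀ {x y} → R x y → R y x) → ∀ {xs} → AllPairs R xs →
                  ∀ {x y} → x ∈ₗ xs → y ∈ₗ xs → x ≢ y → R x y
AllPairs-lookup R-sym (_  ∷ _)  (here refl) (here refl) x≢y = contradiction refl x≢y
AllPairs-lookup R-sym (px ∷ _)  (here refl) (there y∈)  _   = All.lookup px y∈
AllPairs-lookup R-sym (px ∷ _)  (there x∈)  (here refl) _   = R-sym (All.lookup px x∈)
AllPairs-lookup R-sym (_  ∷ ps) (there x∈)  (there y∈)  x≢y = AllPairs-lookup R-sym ps x∈ y∈ x≢y

module _ (_≟ₐ_ : DecidableEquality A) where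

  open import Data.List.Membership.DecPropositional _≟ₐ_ using () renaming (_∈?_ to _∈ₐ?_)

  -- Pigeonhole by deleting `x` from `ys`, which leaves a shorter list still containing the rest of
  -- `xs`. Since `ys` may repeat entries, it can be a concatenation of overlapping lists, as in the
  -- covering arguments below.
  Unique∧⊆⇒length≤ : ∀ {xs ys : List A} → Unique xs → xs ⊆ₗ ys → length xs ≤ length ys
  Unique∧⊆⇒length≤ [] _ = z≤n
  Unique∧⊆⇒length≤ {x ∷ xs} {ys} (x∉xs ∷ xs!) xs⊆ys =
    ≤-trans (s≤s (Unique∧⊆⇒length≤ xs! rest⊆))
            (filter-notAll (¬? ∘ (x ≟ₐ_)) ys (Any.map (λ x≡y x≢y → x≢y x≡y) (xs⊆ys (here refl))))
    where
    rest⊆ : xs ⊆ₗ filter (¬? ∘ (x ≟ₐ_)) ys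
    rest⊆ z∈ = ∈-filter⁺ (¬? ∘ (x ≟ₐ_)) (xs⊆ys (there z∈)) (All.lookup x∉xs z∈)

  surplus : ∀ {xs ys : List A} → Unique xs → length ys < length xs → ∃[ x ] x ∈ₗ xs × x ∉ₗ ys
  surplus {xs} {ys} xs! ys<xs with Any.any? (λ x → ¬? (x ∈ₐ? ys)) xs
  ... | yes some = find some
  ... | no  none = contradiction (Unique∧⊆⇒length≤ xs! all∈) (<⇒≱ ys<xs)
    where
    all∈ : xs ⊆ₗ ys
    all∈ x∈ = decidable-stable (_ ∈ₐ? ys) (λ x∉ → none (lose x∈ x∉))

length≤∣p∣ : ∀ {xs} {p : Subset n} → Unique xs → All (_∈ p) xs → length xs ≤ ∣ p ∣
length≤∣p∣ [] [] = z≤n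
length≤∣p∣ (x∉xs ∷ xs!) (x∈p ∷ xs∈p) =
  ≤-trans (s≤s (length≤∣p∣ xs! (All.zipWith (λ (y∈p , x≢y) → x∈p∧x≢y⇒x∈p-y y∈p (x≢y ∘ sym))
                                            (xs∈p , x∉xs))))
          (x∈p⇒∣p-x∣<∣p∣ x∈p)

-- A member outside `xs` would extend it to a repetition-free list of members longer than `∣ p ∣`.
-- Three named vertices of a hyperedge are thereby all of its vertices.
exhaust : ∀ {xs} {p : Subset n} → Unique xs → All (_∈ p) xs → ∣ p ∣ ≤ length xs →
          ∀ {x} → x ∈ p → x ∈ₗ xs
exhaust {xs = xs} xs! xs∈p ∣p∣≤ {x} x∈p = decidable-stable (Any.any? (x ≟ᶠ_) xs)
  λ x∉xs → 1+n≰n (≤-trans (length≤∣p∣ (All.¬Any⇒All¬ xs x∉xs ∷ xs!) (x∈p ∷ xs∈p)) ∣p∣≤)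

determined : ∀ {xs} {p q : Subset n} → Unique xs → All (_∈ p) xs → All (_∈ q) xs →
             ∣ p ∣ ≤ length xs → ∣ q ∣ ≤ length xs → p ≡ q
determined xs! xs∈p xs∈q ∣p∣≤ ∣q∣≤ = ⊆-antisym
  (All.lookup xs∈q ∘ exhaust xs! xs∈p ∣p∣≤)
  (All.lookup xs∈p ∘ exhaust xs! xs∈q ∣q∣≤)

members : (p : Subset n) → ∃[ xs ] length xs ≡ ∣ p ∣ × Unique xs × All (_∈ p) xs
members []            = [] , refl , [] , []
members (outside ∷ p) with members p
... | xs , len , xs! , xs∈p =
  map suc xs , trans (length-map suc xs) len , Unique.map⁺ suc-injective xs!
  , All.map⁺ (All.map there xs∈p)
members (inside ∷ p) with members p
... | xs , len , xs! , xs∈p =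
  zero ∷ map suc xs , cong suc (trans (length-map suc xs) len)
  , All.map⁺ (All.tabulate (λ _ → 0≢1+n)) ∷ Unique.map⁺ suc-injective xs!
  , here ∷ All.map⁺ (All.map there xs∈p)

two-members : {p : Subset n} → 2 ≤ ∣ p ∣ → ∃[ x ] ∃[ y ] x ≢ y × x ∈ p × y ∈ p
two-members {p = p} 2≤∣p∣ with members p
two-members 2≤∣p∣ | [] , len , _ with () ← ≤-trans 2≤∣p∣ (≤-reflexive (sym len))
two-members 2≤∣p∣ | _ ∷ [] , len , _ with s≤s () ← ≤-trans 2≤∣p∣ (≤-reflexive (sym len))
two-members 2≤∣p∣ | x ∷ y ∷ _ , _ , (x≢y ∷ _) ∷ _ , x∈p ∷ y∈p ∷ _ = x , y , x≢y , x∈p , y∈p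

Distinct₃ : A → A → A → Set
Distinct₃ x y z = x ≢ y × x ≢ z × y ≢ z

unique₃ : {x y z : A} → Distinct₃ x y z → Unique (x ∷ y ∷ z ∷ [])
unique₃ (x≢y , x≢z , y≢z) = (x≢y ∷ x≢z ∷ []) ∷ (y≢z ∷ []) ∷ [] ∷ []

three-members : {p : Subset n} → ∣ p ∣ ≡ 3 →
                ∃[ x ] ∃[ y ] ∃[ z ] Distinct₃ x y z × All (_∈ p) (x ∷ y ∷ z ∷ [])
three-members {p = p} ∣p∣≡3 with members p
... | xs , len , xs! , xs∈p with xs | trans len ∣p∣≡3 | xs! | xs∈p
... | x ∷ y ∷ z ∷ [] | refl | (x≢y ∷ x≢z ∷ []) ∷ (y≢z ∷ []) ∷ _ | xyz∈p =
  x , y , z , (x≢y , x≢z , y≢z) , xyz∈p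

-- Pairs and codegrees

pair : Fin n → Fin n → Subset n
pair u w = ⁅ u ⁆ ∪ ⁅ w ⁆

pair-comm : (u w : Fin n) → pair u w ≡ pair w u
pair-comm u w = ∪-comm ⁅ u ⁆ ⁅ w ⁆

left∈pair : (u w : Fin n) → u ∈ pair u w
left∈pair u w = x∈p∪q⁺ (inj₁ (x∈⁅x⁆ u))

right∈pair : (u w : Fin n) → w ∈ pair u w
right∈pair u w = x∈p∪q⁺ (inj₂ (x∈⁅x⁆ w))

∈pair⁻ : {u w x : Fin n} → x ∈ pair u w → x ≡ u ⊎ x ≡ w
∈pair⁻ {u = u} {w} x∈ with x∈p∪q⁻ ⁅ u ⁆ ⁅ w ⁆ x∈
... | inj₁ x∈u = inj₁ (x∈⁅y⁆⇒x≡y u x∈u)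
... | inj₂ x∈w = inj₂ (x∈⁅y⁆⇒x≡y w x∈w)

pair⊆ : {u w : Fin n} {p : Subset n} → u ∈ p → w ∈ p → pair u w ⊆ p
pair⊆ u∈p w∈p x∈ with ∈pair⁻ x∈
... | inj₁ refl = u∈p
... | inj₂ refl = w∈p

∣pair∣≡2 : {u w : Fin n} → u ≢ w → ∣ pair u w ∣ ≡ 2
∣pair∣≡2 {u = u} {w} u≢w = ≤-antisym upper
  (length≤∣p∣ ((u≢w ∷ []) ∷ [] ∷ []) (left∈pair u w ∷ right∈pair u w ∷ []))
  where
  upper : ∣ pair u w ∣ ≤ 2
  upper with members (pair u w)
  ... | xs , len , xs! , xs∈ = subst (_≤ 2) len (Unique∧⊆⇒length≤ _≟ᶠ_ {ys = u ∷ w ∷ []} xs!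
    λ x∈ → [ here , (λ x≡w → there (here x≡w)) ]′ (∈pair⁻ (All.lookup xs∈ x∈)))

module _ (H : Hypergraph r n) where

  -- Taking a subset instead of two vertices lets `ThickPair` test a graph edge without choosing its
  -- endpoints, and reduces the symmetry of codegrees to `pair-comm`.
  containing : Subset n → List (Subset n)
  containing p = filter (p ⊆?_) (edges H)

  codegree : Fin n → Fin n → ℕ
  codegree u w = length (containing (pair u w))

  containing-unique : ∀ p → Unique (containing p)
  containing-unique p = Unique.filter⁺ (p ⊆?_) (unique H)

  codegree-comm : ∀ u w → codegree u w ≡ codegree w u
  codegree-comm u w = cong (length ∘ containing) (pair-comm u w)

  ∈-containing⁺ : ∀ {u w e} → e ∈ₗ edges H → u ∈ e → w ∈ e → e ∈ₗ containing (pair u w)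
  ∈-containing⁺ {u} {w} e∈H u∈e w∈e = ∈-filter⁺ (pair u w ⊆?_) e∈H (pair⊆ u∈e w∈e)

  ∈-containing⁻ : ∀ {u w e} → e ∈ₗ containing (pair u w) → e ∈ₗ edges H × u ∈ e × w ∈ e
  ∈-containing⁻ {u} {w} e∈ with ∈-filter⁻ (pair u w ⊆?_) {xs = edges H} e∈
  ... | e∈H , p⊆e = e∈H , p⊆e (left∈pair u w) , p⊆e (right∈pair u w)

  Light Heavy : Subset n → Set
  Light e = ∃[ u ] ∃[ w ] u ∈ e × w ∈ e × u ≢ w × codegree u w ≤ 1
  Heavy e = ∃[ u ] ∃[ w ] u ∈ e × w ∈ e × u ≢ w × 3 ≤ codegree u w

  light? : Decidable Light
  light? e = any? λ u → any? λ w →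
    (u ∈? e) ×-dec (w ∈? e) ×-dec ¬? (u ≟ᶠ w) ×-dec (codegree u w ≤? 1)

  heavy? : Decidable Heavy
  heavy? e = any? λ u → any? λ w →
    (u ∈? e) ×-dec (w ∈? e) ×-dec ¬? (u ≟ᶠ w) ×-dec (3 ≤? codegree u w)

-- The cyclic successor

prev : Fin m → Fin m
prev zero    = fromℕ _
prev (suc i) = inject₁ i

next-fromℕ : ∀ m → next (fromℕ m) ≡ zero
next-fromℕ m = toℕ-injective (trans (toℕ-fromℕ< _)
  (trans (cong (λ k → suc k % suc m) (toℕ-fromℕ m)) (n%n≡0 (suc m))))

next-inject₁ : (i : Fin m) → next (inject₁ i) ≡ suc i
next-inject₁ {m} i = toℕ-injective (trans (toℕ-fromℕ< _)
  (trans (cong (λ k → suc k % suc m) (toℕ-inject₁ i)) (m<n⇒m%n≡m (s≤s (toℕ<n i)))))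

prev-next : (i : Fin m) → prev (next i) ≡ i
prev-next i with view i
... | ‵fromℕ {n}  = cong prev (next-fromℕ n)
... | ‵inject₁ j  = cong prev (next-inject₁ j)

next-injective : Injective _≡_ _≡_ (next {m})
next-injective {x = i} {j} eq = trans (sym (prev-next i)) (trans (cong prev eq) (prev-next j))

-- Proved for `prev`, which computes by pattern matching, and then transferred to `next`, whose
-- definition goes through a remainder.
prev-prev≢ : 3 ≤ m → (i : Fin m) → prev (prev i) ≢ i
prev-prev≢ (s≤s (s≤s (s≤s _))) zero          ()
prev-prev≢ (s≤s (s≤s (s≤s _))) (suc zero)    ()
prev-prev≢ (s≤s (s≤s (s≤s _))) (suc (suc i)) eq = <⇒≢ (s≤s (n≤1+n (toℕ i)))
  (trans (sym (trans (toℕ-inject₁ (inject₁ i)) (toℕ-inject₁ i))) (cong toℕ eq))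

next-next≢ : 3 ≤ m → (i : Fin m) → next (next i) ≢ i
next-next≢ 3≤m i eq = prev-prev≢ 3≤m i
  (trans (cong (prev ∘ prev) (sym eq)) (trans (cong prev (prev-next (next i))) (prev-next i)))

-- Edges without a pair of codegree at most one

module _ (H : Hypergraph 3 n) where

  private
    ThickPair : Subset n → Set
    ThickPair p = ∣ p ∣ ≡ 2 × 2 ≤ length (containing H p)

    thickPair? : Decidable ThickPair
    thickPair? p = (∣ p ∣ ≟ 2) ×-dec (2 ≤? length (containing H p))

    ∣edge∣≡3 : ∀ {e} → e ∈ₗ edges H → ∣ e ∣ ≡ 3
    ∣edge∣≡3 = All.lookup (uniform H)

  thickGraph : Graph n
  thickGraph = record
    { edges   = filter thickPair? (allSubsets n)
    ; unique  = Unique.filter⁺ thickPair? (allSubsets-unique n)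
    ; uniform = All.map proj₁ (All.all-filter thickPair? (allSubsets n))
    }

  -- At most one edge through u and w contains x, namely {u, w, x}.
  avoiding : ∀ {u w} x → u ≢ w → x ≢ u → x ≢ w → 2 ≤ codegree H u w →
             ∃[ e ] e ∈ₗ containing H (pair u w) × ¬ x ∈ e
  avoiding {u} {w} x u≢w x≢u x≢w 2≤ with containing H (pair u w) in eq | 2≤
  ... | _ ∷ []     | s≤s ()
  ... | e ∷ f ∷ es | _ with x ∈? e | x ∈? f
  ...   | no  x∉e | _       = e , here refl , x∉e
  ...   | yes _   | no x∉f  = f , there (here refl) , x∉f
  ...   | yes x∈e | yes x∈f = contradiction e≡f e≢f
    where
    e∈ : e ∈ₗ containing H (pair u w)
    e∈ = subst (e ∈ₗ_) (sym eq) (here refl)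
    f∈ : f ∈ₗ containing H (pair u w)
    f∈ = subst (f ∈ₗ_) (sym eq) (there (here refl))
    e≢f : e ≢ f
    e≢f with subst Unique eq (containing-unique H (pair u w))
    ... | (e≢f ∷ _) ∷ _ = e≢f
    e≡f : e ≡ f
    e≡f with ∈-containing⁻ H e∈ | ∈-containing⁻ H f∈
    ... | e∈H , u∈e , w∈e | f∈H , u∈f , w∈f =
      determined (unique₃ (x≢u , x≢w , u≢w)) (x∈e ∷ u∈e ∷ w∈e ∷ []) (x∈f ∷ u∈f ∷ w∈f ∷ [])
        (≤-reflexive (∣edge∣≡3 e∈H)) (≤-reflexive (∣edge∣≡3 f∈H))

  -- Representing v i and v (i + 1) by an edge that misses v (i + 2) makes the
  -- representatives distinct: two pairs inside one edge are consecutive, and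
  -- the edge then contains the vertex missed by the representative of the first pair.
  thickGraph-cycle : Cycle m thickGraph → BergeCycle m H
  thickGraph-cycle {m} c = record
    { 0<m        = ≤-trans (s≤s z≤n) 3≤m
    ; h          = h
    ; h-edge     = λ i → proj₁ (h∋ i)
    ; h-distinct = λ {i} {j} → h-distinct i j
    ; v          = v
    ; v-distinct = v-distinct
    ; v∈h        = λ i → proj₁ (proj₂ (h∋ i))
    ; v-next∈h   = λ i → proj₂ (proj₂ (h∋ i))
    }
    where
    open Cycle c
    next≢ : ∀ i → next i ≢ i
    next≢ i eq = next-next≢ 3≤m i (trans (cong next eq) eq)
    representative : ∀ i → ∃[ e ] e ∈ₗ containing H (pair (v i) (v (next i))) ×
                                  ¬ v (next (next i)) ∈ e
    representative i = avoiding (v (next (next i)))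
      (λ eq → next≢ i (sym (v-distinct eq)))
      (λ eq → next-next≢ 3≤m i (v-distinct eq))
      (λ eq → next≢ (next i) (v-distinct eq))
      (proj₂ (proj₂ (∈-filter⁻ thickPair? {xs = allSubsets n} (v-adjacent i))))
    h : Fin m → Subset n
    h i = proj₁ (representative i)
    h∋ : ∀ i → h i ∈ₗ edges H × v i ∈ h i × v (next i) ∈ h i
    h∋ i = ∈-containing⁻ H (proj₁ (proj₂ (representative i)))
    h∌ : ∀ i → ¬ v (next (next i)) ∈ h i
    h∌ i = proj₂ (proj₂ (representative i))
    h-distinct : ∀ i j → h i ≡ h j → i ≡ j
    h-distinct i j eq with i ≟ᶠ j
    ... | yes i≡j = i≡j
    ... | no  i≢j = contradiction (≤-trans four (≤-reflexive (∣edge∣≡3 (proj₁ (h∋ i))))) 1+n≰n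
      where
      h∋j : v j ∈ h i × v (next j) ∈ h i
      h∋j = subst (λ e → v j ∈ e × v (next j) ∈ e) (sym eq) (proj₂ (h∋ j))
      j≢next-i : j ≢ next i
      j≢next-i refl = h∌ i (proj₂ h∋j)
      i≢next-j : i ≢ next j
      i≢next-j refl = h∌ j (subst (v (next i) ∈_) eq (proj₂ (proj₂ (h∋ i))))
      four : 4 ≤ ∣ h i ∣
      four = length≤∣p∣ {xs = map v (i ∷ next i ∷ j ∷ next j ∷ [])}
        (Unique.map⁺ v-distinct
          ((next≢ i ∘ sym ∷ i≢j ∷ i≢next-j ∷ [])
          ∷ (j≢next-i ∘ sym ∷ i≢j ∘ next-injective ∷ [])
          ∷ (next≢ j ∘ sym ∷ []) ∷ [] ∷ []))
        (proj₁ (proj₂ (h∋ i)) ∷ proj₂ (proj₂ (h∋ i)) ∷ proj₁ h∋j ∷ proj₂ h∋j ∷ [])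

  dark-triangle : ∀ {e} → e ∈ₗ edges H → ¬ Light H e → IsTriangle thickGraph e
  dark-triangle e∈H ¬light = ∣edge∣≡3 e∈H , λ {u} {w} u∈e w∈e u≢w →
    ∈-filter⁺ thickPair? (∈-allSubsets (pair u w))
      (∣pair∣≡2 u≢w , ≰⇒> (λ ≤1 → ¬light (u , w , u∈e , w∈e , u≢w , ≤1)))

  -- A triangle is a vertex set here, so the injection from hyperedges to triangles is the identity:
  -- every pair inside a hyperedge that is not light has codegree at least two.
  dark-count : length (filter (¬? ∘ light? H) (edges H)) ≤ triangleCount thickGraph
  dark-count = Unique∧⊆⇒length≤ _≟ˢ_ (Unique.filter⁺ (¬? ∘ light? H) (unique H)) λ {e} e∈ →
    let e∈H , ¬light = ∈-filter⁻ (¬? ∘ light? H) {xs = edges H} e∈ in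
    ∈-filter⁺ (isTriangle? thickGraph) (∈-allSubsets e) (dark-triangle e∈H ¬light)

-- Edges all of whose pairs have codegree at most two

-- Greedy choice from the end of the list: `x` is kept unless it is related to an element already
-- kept. Reflexivity lets a kept element cover itself and makes unrelated elements distinct.
maximalIndependent : {R : A → A → Set} → (∀ x y → Dec (R x y)) → ∀ xs → All (λ x → R x x) xs →
  ∃[ ys ] ys ⊆ₗ xs × AllPairs (λ x y → x ≢ y × ¬ R x y) ys × All (λ x → Any (R x) ys) xs
maximalIndependent R? []       []            = [] , id , [] , []
maximalIndependent {R = R} R? (x ∷ xs) (Rxx ∷ Rxs) with maximalIndependent R? xs Rxs
... | ys , ys⊆xs , ys-indep , ys-cover with Any.any? (R? x) ys
...   | yes x-covered = ys , there ∘ ys⊆xs , ys-indep , x-covered ∷ ys-cover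
...   | no  x-free    = x ∷ ys
  , (λ { (here eq) → here eq ; (there y∈) → there (ys⊆xs y∈) })
  , All.map (λ ¬Rxy → (λ x≡y → ¬Rxy (subst (R x) x≡y Rxx)) , ¬Rxy) (All.¬Any⇒All¬ ys x-free)
    ∷ ys-indep
  , here Rxx ∷ All.map there ys-cover

BergeCycle-mono : {H K : Hypergraph r n} → H ⊑ K → BergeCycle m H → BergeCycle m K
BergeCycle-mono H⊑K c = record
  { 0<m = 0<m ; h = h ; h-edge = H⊑K ∘ h-edge ; h-distinct = h-distinct
  ; v = v ; v-distinct = v-distinct ; v∈h = v∈h ; v-next∈h = v-next∈h }
  where open BergeCycle c

module _ (H : Hypergraph 3 n) where

  private
    -- For distinct edges this is exactly the failure of linearity. An edge also meets itself, so
    -- `neighbours f` includes `f` and the families of neighbours of the chosen edges cover the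
    -- chosen edges too.
    Meets : Subset n → Subset n → Set
    Meets e f = 2 ≤ ∣ e ∩ f ∣

    meets? : ∀ e f → Dec (Meets e f)
    meets? e f = 2 ≤? ∣ e ∩ f ∣

    neighbours : Subset n → List (Subset n)
    neighbours f = filter (λ e → meets? e f) (edges H)

  -- Each of the six ordered pairs of vertices of f lies in at most two edges.
  neighbours-count : ∀ {f} → f ∈ₗ edges H → ¬ Heavy H f → length (neighbours f) ≤ 12
  neighbours-count {f} f∈H ¬heavy with three-members (All.lookup (uniform H) f∈H)
  ... | a , b , c , (a≢b , a≢c , b≢c) , abc∈f@(a∈f ∷ b∈f ∷ c∈f ∷ []) = ≤-trans
    (Unique∧⊆⇒length≤ _≟ˢ_ {ys = concatMap through pairs}
      (Unique.filter⁺ (λ e → meets? e f) (unique H)) covered)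
    (length-concatMap-≤ through
      ( few a∈f b∈f a≢b ∷ few a∈f c∈f a≢c ∷ few b∈f a∈f (a≢b ∘ sym)
      ∷ few b∈f c∈f b≢c ∷ few c∈f a∈f (a≢c ∘ sym) ∷ few c∈f b∈f (b≢c ∘ sym) ∷ []))
    where
    through : Fin n × Fin n → List (Subset n)
    through (u , w) = containing H (pair u w)
    -- Both orders are listed because the two common vertices found in `covered` come in an
    -- unspecified order. Six pairs with at most two edges each give the constant 12.
    pairs : List (Fin n × Fin n)
    pairs = (a , b) ∷ (a , c) ∷ (b , a) ∷ (b , c) ∷ (c , a) ∷ (c , b) ∷ []
    few : ∀ {u w} → u ∈ f → w ∈ f → u ≢ w → codegree H u w ≤ 2
    few {u} {w} u∈f w∈f u≢w = ≮⇒≥ (λ 3≤ → ¬heavy (u , w , u∈f , w∈f , u≢w , 3≤))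
    ordered : ∀ {u w} → u ≢ w → u ∈ₗ a ∷ b ∷ c ∷ [] → w ∈ₗ a ∷ b ∷ c ∷ [] → (u , w) ∈ₗ pairs
    ordered u≢w (here refl)                 (here refl)                 = contradiction refl u≢w
    ordered u≢w (here refl)                 (there (here refl))         = here refl
    ordered u≢w (here refl)                 (there (there (here refl))) = there (here refl)
    ordered u≢w (there (here refl))         (here refl)                 = there (there (here refl))
    ordered u≢w (there (here refl))         (there (here refl))         = contradiction refl u≢w
    ordered u≢w (there (here refl))         (there (there (here refl))) =
      there (there (there (here refl)))
    ordered u≢w (there (there (here refl))) (here refl)                 =
      there (there (there (there (here refl))))
    ordered u≢w (there (there (here refl))) (there (here refl))         =
      there (there (there (there (there (here refl)))))
    ordered u≢w (there (there (here refl))) (there (there (here refl))) = contradiction refl u≢w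
    covered : neighbours f ⊆ₗ concatMap through pairs
    covered {e} e∈ with ∈-filter⁻ (λ e → meets? e f) {xs = edges H} e∈
    ... | e∈H , meets with two-members meets
    ...   | u , w , u≢w , u∈ , w∈ with x∈p∩q⁻ e f u∈ | x∈p∩q⁻ e f w∈
    ...     | u∈e , u∈f | w∈e , w∈f = ∈-concatMap⁺ through
      (lose (ordered u≢w (listed u∈f) (listed w∈f)) (∈-containing⁺ H e∈H u∈e w∈e))
      where
      listed : ∀ {x} → x ∈ f → x ∈ₗ a ∷ b ∷ c ∷ []
      listed = exhaust (unique₃ (a≢b , a≢c , b≢c)) abc∈f
        (≤-reflexive (All.lookup (uniform H) f∈H))

  -- A maximal subfamily of `es` whose members pairwise do not meet is linear. By maximality every
  -- edge of `es` is a neighbour of a chosen one, and a chosen edge, having no heavy pair, has at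
  -- most 12 neighbours.
  linear-part : ∀ {es} → Unique es → All (λ e → e ∈ₗ edges H × ¬ Heavy H e) es →
                ∃[ K ] Linear K × K ⊑ H × length es ≤ 12 * size K
  linear-part {es} es! es-thin
    with maximalIndependent meets? es (All.map (reflexive ∘ proj₁) es-thin)
    where
    reflexive : ∀ {e} → e ∈ₗ edges H → Meets e e
    reflexive {e} e∈H =
      subst (2 ≤_) (sym (trans (cong ∣_∣ (∩-idem e)) (All.lookup (uniform H) e∈H))) (n≤1+n 2)
  ... | fs , fs⊆es , fs-indep , fs-cover = K , linear , fs⊑H , count
    where
    fs⊑H : fs ⊆ₗ edges H
    fs⊑H = proj₁ ∘ All.lookup es-thin ∘ fs⊆es
    K : Hypergraph 3 n
    K = record { edges   = fs
               ; unique  = AllPairs.map proj₁ fs-indep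
               ; uniform = All.tabulate (All.lookup (uniform H) ∘ fs⊑H) }
    linear : Linear K
    linear e∈ f∈ e≢f = ≮⇒≥ (AllPairs-lookup
      (λ {e} {f} ¬meets → ¬meets ∘ subst (2 ≤_) (cong ∣_∣ (∩-comm f e)))
      (AllPairs.map proj₂ fs-indep) e∈ f∈ e≢f)
    count : length es ≤ 12 * length fs
    count = ≤-trans
      (Unique∧⊆⇒length≤ _≟ˢ_ es! λ {e} e∈ → ∈-concatMap⁺ neighbours
        (Any.map (∈-filter⁺ (λ e → meets? e _) (proj₁ (All.lookup es-thin e∈)))
                 (All.lookup fs-cover e∈)))
      (length-concatMap-≤ neighbours
        (All.tabulate λ f∈ → let f∈H , ¬heavy = All.lookup es-thin (fs⊆es f∈) in
                             neighbours-count f∈H ¬heavy))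

-- Averaging over two-colourings of the vertices

-- A subset stands for a two-colouring of the vertices. Probabilities are expressed without
-- division, by comparing sums over all colourings; `Σˢ (λ _ → 1)` is the number of colourings.
Σˢ : (Subset n → ℕ) → ℕ
Σˢ {zero}  f = f []
Σˢ {suc n} f = Σˢ (f ∘ (inside ∷_)) + Σˢ (f ∘ (outside ∷_))

Σˢ-cong : {f g : Subset n → ℕ} → (∀ s → f s ≡ g s) → Σˢ f ≡ Σˢ g
Σˢ-cong {zero}  eq = eq []
Σˢ-cong {suc n} eq = cong₂ _+_ (Σˢ-cong (eq ∘ (inside ∷_))) (Σˢ-cong (eq ∘ (outside ∷_)))

+-interchange : ∀ a b c d → (a + b) + (c + d) ≡ (a + c) + (b + d)
+-interchange = solve 4 (λ a b c d → (a :+ b) :+ (c :+ d) := (a :+ c) :+ (b :+ d)) refl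
  where open +-*-Solver

Σˢ-+ : (f g : Subset n → ℕ) → Σˢ (λ s → f s + g s) ≡ Σˢ f + Σˢ g
Σˢ-+ {zero}  f g = refl
Σˢ-+ {suc n} f g = trans
  (cong₂ _+_ (Σˢ-+ (f ∘ (inside ∷_)) (g ∘ (inside ∷_)))
             (Σˢ-+ (f ∘ (outside ∷_)) (g ∘ (outside ∷_))))
  (+-interchange (Σˢ (f ∘ (inside ∷_))) _ _ _)

-- If the sum of `f` exceeded that of `g` on both halves, it would exceed it in total; so the
-- inequality persists on one half, and the search descends there.
Σˢ-≤⇒∃≤ : (f g : Subset n → ℕ) → Σˢ f ≤ Σˢ g → ∃[ s ] f s ≤ g s
Σˢ-≤⇒∃≤ {zero}  f g f≤g = [] , f≤g
Σˢ-≤⇒∃≤ {suc n} f g f≤g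
  with Σˢ (f ∘ (inside ∷_)) ≤? Σˢ (g ∘ (inside ∷_))
     | Σˢ (f ∘ (outside ∷_)) ≤? Σˢ (g ∘ (outside ∷_))
... | yes ≤in | _ = let s , fs≤gs = Σˢ-≤⇒∃≤ _ _ ≤in in inside ∷ s , fs≤gs
... | no _ | yes ≤out = let s , fs≤gs = Σˢ-≤⇒∃≤ _ _ ≤out in outside ∷ s , fs≤gs
... | no ≰in | no ≰out = contradiction f≤g (<⇒≱ (+-mono-< (≰⇒> ≰in) (≰⇒> ≰out)))

toggle : Fin n → Subset n → Subset n
toggle i s = updateAt s i not

-- Recolouring one vertex permutes the colourings: at its own coordinate it exchanges the two
-- summands.
Σˢ-toggle : (i : Fin n) (f : Subset n → ℕ) → Σˢ (f ∘ toggle i) ≡ Σˢ f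
Σˢ-toggle zero    f = +-comm (Σˢ (f ∘ (outside ∷_))) _
Σˢ-toggle (suc i) f =
  cong₂ _+_ (Σˢ-toggle i (f ∘ (inside ∷_))) (Σˢ-toggle i (f ∘ (outside ∷_)))

indicator : {P : Set} → Dec P → ℕ
indicator P? = if does P? then 1 else 0

length-filter-∷ : {P : A → Set} (P? : Decidable P) (x : A) (xs : List A) →
                  length (filter P? (x ∷ xs)) ≡ indicator (P? x) + length (filter P? xs)
length-filter-∷ P? x xs with does (P? x)
... | true  = refl
... | false = refl

-- The hypothesis says that each `x` is good for at least a fraction 1/k of the colourings. Adding
-- this up over `xs` and exchanging the two sums bounds the total count of good pairs, and some
-- colouring does at least as well as the average.
averaging : {P : Subset n → A → Set} (P? : ∀ s → Decidable (P s)) → ∀ k {xs} →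
            All (λ x → Σˢ {n} (λ _ → 1) ≤ Σˢ (λ s → k * indicator (P? s x))) xs →
            ∃[ s ] length xs ≤ k * length (filter (P? s) xs)
averaging {n = n} P? k {xs} all = Σˢ-≤⇒∃≤ (λ _ → length xs) _ (total all)
  where
  total : ∀ {xs} → All (λ x → Σˢ {n} (λ _ → 1) ≤ Σˢ (λ s → k * indicator (P? s x))) xs →
          Σˢ {n} (λ _ → length xs) ≤ Σˢ (λ s → k * length (filter (P? s) xs))
  total []                     = ≤-reflexive (Σˢ-cong {n} (λ _ → sym (*-zeroʳ k)))
  total {x ∷ xs} (x-often ∷ often) = begin
    Σˢ {n} (λ _ → 1 + length xs)
      ≡⟨ Σˢ-+ {n} (λ _ → 1) (λ _ → length xs) ⟩
    Σˢ {n} (λ _ → 1) + Σˢ {n} (λ _ → length xs)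
      ≤⟨ +-mono-≤ x-often (total often) ⟩
    Σˢ (λ s → k * indicator (P? s x)) + Σˢ (λ s → k * length (filter (P? s) xs))
      ≡⟨ Σˢ-+ (λ s → k * indicator (P? s x)) _ ⟨
    Σˢ (λ s → k * indicator (P? s x) + k * length (filter (P? s) xs))
      ≡⟨ Σˢ-cong (λ s → trans (cong (k *_) (length-filter-∷ (P? s) x xs))
                              (*-distribˡ-+ k (indicator (P? s x)) _)) ⟨
    Σˢ (λ s → k * length (filter (P? s) (x ∷ xs))) ∎
    where open ≤-Reasoning

Splits : Subset n → Fin n → Fin n → Fin n → Set
Splits s a b c = lookup s a ≡ lookup s b × lookup s c ≢ lookup s a

splits? : (s : Subset n) (a b c : Fin n) → Dec (Splits s a b c)
splits? s a b c = (lookup s a ≟ᵇ lookup s b) ×-dec ¬? (lookup s c ≟ᵇ lookup s a)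

-- Exactly one of the four colourings obtained by recolouring b and c splits {a, b} from c.
Σˢ-splits : {a b c : Fin n} → Distinct₃ a b c →
            Σˢ {n} (λ _ → 1) ≡ Σˢ (λ s → 4 * indicator (splits? s a b c))
Σˢ-splits {n} {a} {b} {c} (a≢b , a≢c , b≢c) = begin
  Σˢ {n} (λ _ → 1)
    ≡⟨ Σˢ-cong one ⟩
  Σˢ (λ s → (χ s + χ (toggle b s)) + (χ (toggle c s) + χ (toggle b (toggle c s))))
    ≡⟨ trans (Σˢ-+ (λ s → χ s + χ (toggle b s)) _)
             (cong₂ _+_ (Σˢ-+ χ _) (Σˢ-+ (χ ∘ toggle c) _)) ⟩
  (Σˢ χ + Σˢ (χ ∘ toggle b)) + (Σˢ (χ ∘ toggle c) + Σˢ (χ ∘ toggle b ∘ toggle c))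
    ≡⟨ cong₂ _+_ (cong (Σˢ χ +_) (Σˢ-toggle b χ))
         (cong₂ _+_ (Σˢ-toggle c χ)
           (trans (Σˢ-toggle c (χ ∘ toggle b)) (Σˢ-toggle b χ))) ⟩
  (Σˢ χ + Σˢ χ) + (Σˢ χ + Σˢ χ)
    ≡⟨ trans (Σˢ-+ (λ s → χ s + χ s) _) (cong₂ _+_ (Σˢ-+ χ χ) (Σˢ-+ χ χ)) ⟨
  Σˢ (λ s → (χ s + χ s) + (χ s + χ s))
    ≡⟨ Σˢ-cong (λ s → solve 1 (λ x → (x :+ x) :+ (x :+ x) := con 4 :* x) refl (χ s)) ⟩
  Σˢ (λ s → 4 * χ s) ∎
  where
  open ≡-Reasoning
  open +-*-Solver
  χ : Subset n → ℕ
  χ s = indicator (splits? s a b c)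
  χ-bits : Bool → Bool → Bool → ℕ
  χ-bits x y z = indicator ((x ≟ᵇ y) ×-dec ¬? (z ≟ᵇ x))
  one-bits : ∀ x y z →
    1 ≡ (χ-bits x y z + χ-bits x (not y) z) + (χ-bits x y (not z) + χ-bits x (not y) (not z))
  one-bits true  true  true  = refl
  one-bits true  true  false = refl
  one-bits true  false true  = refl
  one-bits true  false false = refl
  one-bits false true  true  = refl
  one-bits false true  false = refl
  one-bits false false true  = refl
  one-bits false false false = refl
  one : ∀ s → 1 ≡ (χ s + χ (toggle b s)) + (χ (toggle c s) + χ (toggle b (toggle c s)))
  -- Rewriting turns each colour after toggling into an original colour or its negation, which
  -- leaves the eight cases of `one-bits`.
  one s
    rewrite lookup∘updateAt′ a b {not} a≢b s | lookup∘updateAt b {not} s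
          | lookup∘updateAt′ c b {not} (b≢c ∘ sym) s
          | lookup∘updateAt′ a b {not} a≢b (toggle c s) | lookup∘updateAt b {not} (toggle c s)
          | lookup∘updateAt′ c b {not} (b≢c ∘ sym) (toggle c s)
          | lookup∘updateAt′ a c {not} a≢c s | lookup∘updateAt c {not} s
          | lookup∘updateAt′ b c {not} b≢c s
    = one-bits (lookup s a) (lookup s b) (lookup s c)

-- Edges with both a light and a heavy pair

module _ (H : Hypergraph 3 n) where

  -- The light pair and the heavy pair share the vertex `a`. An edge may have several such pairs, so
  -- the record carries the choice.
  record Configuration (e : Subset n) : Set where
    field
      edge     : e ∈ₗ edges H
      a b c    : Fin n
      distinct : Distinct₃ a b c
      a∈       : a ∈ e
      b∈       : b ∈ e
      c∈       : c ∈ e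
      light    : codegree H a b ≤ 1
      heavy    : 3 ≤ codegree H a c

  open Configuration

  -- Two pairs inside a 3-set have a common vertex, since otherwise the edge would have four
  -- vertices. They cannot coincide, because one codegree is at most one and the other at least
  -- three. Swapping endpoints brings the common vertex to `a`.
  configuration : ∀ {e} → e ∈ₗ edges H → Light H e → Heavy H e → Configuration e
  configuration {e} e∈H (a , b , a∈e , b∈e , a≢b , light) (u , w , u∈e , w∈e , u≢w , heavy) =
    analyse (u ≟ᶠ a) (u ≟ᶠ b) (w ≟ᶠ a) (w ≟ᶠ b)
    where
    light′ : codegree H b a ≤ 1
    light′ = subst (_≤ 1) (codegree-comm H a b) light
    heavy′ : 3 ≤ codegree H w u
    heavy′ = subst (3 ≤_) (codegree-comm H u w) heavy
    at-a : ∀ {c} → c ∈ e → a ≢ c → b ≢ c → 3 ≤ codegree H a c → Configuration e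
    at-a {c} c∈e a≢c b≢c heavy = record
      { edge = e∈H ; a = a ; b = b ; c = c ; distinct = a≢b , a≢c , b≢c
      ; a∈ = a∈e ; b∈ = b∈e ; c∈ = c∈e ; light = light ; heavy = heavy }
    at-b : ∀ {c} → c ∈ e → a ≢ c → b ≢ c → 3 ≤ codegree H b c → Configuration e
    at-b {c} c∈e a≢c b≢c heavy = record
      { edge = e∈H ; a = b ; b = a ; c = c ; distinct = a≢b ∘ sym , b≢c , a≢c
      ; a∈ = b∈e ; b∈ = a∈e ; c∈ = c∈e ; light = light′ ; heavy = heavy }
    clash : ∀ {k} → k ≤ 1 → 3 ≤ k → Configuration e
    clash k≤1 3≤k with s≤s () ← ≤-trans 3≤k k≤1
    analyse : Dec (u ≡ a) → Dec (u ≡ b) → Dec (w ≡ a) → Dec (w ≡ b) → Configuration e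
    analyse (yes refl) _ _ (yes refl) = clash light heavy
    analyse (yes refl) _ _ (no w≢b)   = at-a w∈e u≢w (w≢b ∘ sym) heavy
    analyse (no _) (yes refl) (yes refl) _ = clash light′ heavy
    analyse (no _) (yes refl) (no w≢a)   _ = at-b w∈e (w≢a ∘ sym) u≢w heavy
    analyse (no u≢a) (no u≢b) (yes refl) _ = at-a u∈e (u≢a ∘ sym) (u≢b ∘ sym) heavy′
    analyse (no u≢a) (no u≢b) (no _) (yes refl) = at-b u∈e (u≢a ∘ sym) (u≢b ∘ sym) heavy′
    analyse (no u≢a) (no u≢b) (no w≢a) (no w≢b) = contradiction
      (≤-trans (length≤∣p∣ {xs = u ∷ w ∷ a ∷ b ∷ []}
        ((u≢w ∷ u≢a ∷ u≢b ∷ []) ∷ (w≢a ∷ w≢b ∷ []) ∷ (a≢b ∷ []) ∷ [] ∷ [])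
        (u∈e ∷ w∈e ∷ a∈e ∷ b∈e ∷ []))
        (≤-reflexive (All.lookup (uniform H) e∈H)))
      1+n≰n

  lightPair : ∃ Configuration → Subset n
  lightPair (_ , C) = pair (a C) (b C)

  -- Two distinct edges with the same light pair would give it codegree two. Only the edges are
  -- identified, as one edge can carry several configurations on the same light pair. This makes the
  -- light graph have one edge per selected hyperedge.
  lightPair-injective : ∀ {C D} → lightPair C ≡ lightPair D → proj₁ C ≡ proj₁ D
  lightPair-injective {e , C} {f , D} eq with e ≟ˢ f
  ... | yes e≡f = e≡f
  ... | no  e≢f = contradiction (≤-trans two (light C)) 1+n≰n
    where
    two : 2 ≤ codegree H (a C) (b C)
    two = Unique∧⊆⇒length≤ _≟ˢ_ {xs = e ∷ f ∷ []} ((e≢f ∷ []) ∷ [] ∷ [])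
      λ { (here refl) → ∈-containing⁺ H (edge C) (a∈ C) (b∈ C)
        ; (there (here refl)) → subst (λ p → f ∈ₗ containing H p) (sym eq)
                                  (∈-containing⁺ H (edge D) (a∈ D) (b∈ D)) }

  -- The cycle w, v 0, …, v m, with e joining w to v 0 and g i joining v i to its successor.
  detour : (v : Fin (suc m) → Fin n) (w : Fin n) (e : Subset n) (g : Fin (suc m) → Subset n) →
           Injective _≡_ _≡_ v → (∀ i → w ≢ v i) →
           Injective _≡_ _≡_ g → (∀ i → e ≢ g i) →
           e ∈ₗ edges H → (∀ i → g i ∈ₗ edges H) →
           w ∈ e → v zero ∈ e →
           (∀ i → v i ∈ g i) → (∀ i → v (suc i) ∈ g (inject₁ i)) → w ∈ g (fromℕ m) →
           BergeCycle (2 + m) H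
  detour {m} v w e g v-inj w∉v g-inj e∉g e∈H g∈H w∈e v₀∈e v∈g v⁺∈g w∈gₘ = record
    { 0<m = s≤s z≤n
    ; h = h ; h-edge = λ { zero → e∈H ; (suc i) → g∈H i } ; h-distinct = λ {i} {j} → h-inj i j
    ; v = u ; v-distinct = λ {i} {j} → u-inj i j
    ; v∈h = λ { zero → w∈e ; (suc i) → v∈g i } ; v-next∈h = u-next∈h
    }
    where
    h : Fin (2 + m) → Subset n
    h zero    = e
    h (suc i) = g i
    u : Fin (2 + m) → Fin n
    u zero    = w
    u (suc i) = v i
    h-inj : ∀ i j → h i ≡ h j → i ≡ j
    h-inj zero    zero    _  = refl
    h-inj zero    (suc j) eq = contradiction eq (e∉g j)
    h-inj (suc i) zero    eq = contradiction (sym eq) (e∉g i)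
    h-inj (suc i) (suc j) eq = cong suc (g-inj eq)
    u-inj : ∀ i j → u i ≡ u j → i ≡ j
    u-inj zero    zero    _  = refl
    u-inj zero    (suc j) eq = contradiction eq (w∉v j)
    u-inj (suc i) zero    eq = contradiction (sym eq) (w∉v i)
    u-inj (suc i) (suc j) eq = cong suc (v-inj eq)
    u-next∈h : ∀ i → u (next i) ∈ h i
    u-next∈h i with view i
    ... | ‵fromℕ rewrite next-fromℕ (suc m) = w∈gₘ
    ... | ‵inject₁ zero rewrite next-inject₁ {suc m} zero = v₀∈e
    ... | ‵inject₁ (suc j) rewrite next-inject₁ (suc j) = v⁺∈g j

  module _ (s : Subset n) (Cs : List (∃ Configuration))
           (splits : All (λ (_ , C) → Splits s (a C) (b C) (c C)) Cs)
           (Cs! : Unique (map proj₁ Cs)) where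

    lightGraph : Graph n
    lightGraph = record
      { edges   = map lightPair Cs
      ; unique  = AllPairs.map⁺ (AllPairs.map (λ {C} {D} e≢f → e≢f ∘ lightPair-injective {C} {D})
                                              (AllPairs.map⁻ Cs!))
      ; uniform = All.map⁺ (All.tabulate λ { {_ , C} _ → ∣pair∣≡2 (proj₁ (distinct C)) })
      }

    -- The vertices of a cycle of light pairs have one colour and the third vertex of
    -- each configuration has the other; one of these can be inserted into the cycle
    -- because a heavy pair lies in an edge outside the two configurations at its end.
    lightGraph-cycle : Cycle m lightGraph → BergeCycle (suc m) H
    lightGraph-cycle {zero} cycle with () ← Cycle.3≤m cycle
    lightGraph-cycle {suc m} cycle = result
      where
      open Cycle cycle
      config : ∀ i → ∃[ C ] C ∈ₗ Cs × pair (v i) (v (next i)) ≡ lightPair C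
      config i = ∈-map⁻ lightPair (v-adjacent i)
      T : Fin (suc m) → Subset n
      T i = proj₁ (proj₁ (config i))
      C : ∀ i → Configuration (T i)
      C i = proj₂ (proj₁ (config i))
      C-splits : ∀ i → Splits s (a (C i)) (b (C i)) (c (C i))
      C-splits i = All.lookup splits (proj₁ (proj₂ (config i)))
      pair≡ : ∀ i → pair (v i) (v (next i)) ≡ pair (a (C i)) (b (C i))
      pair≡ i = proj₂ (proj₂ (config i))
      v∈C : ∀ i → v i ∈ pair (a (C i)) (b (C i))
      v∈C i = subst (v i ∈_) (pair≡ i) (left∈pair (v i) (v (next i)))
      v⁺∈C : ∀ i → v (next i) ∈ pair (a (C i)) (b (C i))
      v⁺∈C i = subst (v (next i) ∈_) (pair≡ i) (right∈pair (v i) (v (next i)))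
      v∈T : ∀ i → v i ∈ T i
      v∈T i = pair⊆ (a∈ (C i)) (b∈ (C i)) (v∈C i)
      v⁺∈T : ∀ i → v (next i) ∈ T i
      v⁺∈T i = pair⊆ (a∈ (C i)) (b∈ (C i)) (v⁺∈C i)

      colour : Fin n → Bool
      colour = lookup s
      colour-pair : ∀ i {x} → x ∈ pair (a (C i)) (b (C i)) → colour x ≡ colour (a (C i))
      colour-pair i x∈ with ∈pair⁻ x∈
      ... | inj₁ refl = refl
      ... | inj₂ refl = sym (proj₁ (C-splits i))
      colour-next : ∀ i → colour (v (next i)) ≡ colour (v i)
      colour-next i = trans (colour-pair i (v⁺∈C i)) (sym (colour-pair i (v∈C i)))
      colour-v : ∀ i → colour (v i) ≡ colour (v zero)
      colour-v = <-weakInduction (λ i → colour (v i) ≡ colour (v zero)) refl λ i ih →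
        trans (cong (colour ∘ v) (sym (next-inject₁ i))) (trans (colour-next (inject₁ i)) ih)
      c≢v : ∀ i j → c (C i) ≢ v j
      c≢v i j eq = proj₂ (C-splits i) (trans (cong colour eq)
        (trans (colour-v j) (trans (sym (colour-v i)) (colour-pair i (v∈C i)))))

      v∈pair⇒ : ∀ i {j} → v j ∈ pair (a (C i)) (b (C i)) → j ≡ i ⊎ j ≡ next i
      v∈pair⇒ i {j} vj∈ with ∈pair⁻ (subst (v j ∈_) (sym (pair≡ i)) vj∈)
      ... | inj₁ eq = inj₁ (v-distinct eq)
      ... | inj₂ eq = inj₂ (v-distinct eq)
      -- The third vertex of `T i` has the colour absent from the cycle, so `T i` meets the cycle
      -- only in its light pair.
      v∈T⇒ : ∀ i {j} → v j ∈ T i → j ≡ i ⊎ j ≡ next i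
      v∈T⇒ i {j} vj∈T with exhaust (unique₃ (distinct (C i)))
        (a∈ (C i) ∷ b∈ (C i) ∷ c∈ (C i) ∷ [])
        (≤-reflexive (All.lookup (uniform H) (edge (C i)))) vj∈T
      ... | here eq = v∈pair⇒ i (subst (_∈ pair (a (C i)) (b (C i))) (sym eq) (left∈pair _ _))
      ... | there (here eq) = v∈pair⇒ i (subst (_∈ pair (a (C i)) (b (C i))) (sym eq) (right∈pair _ _))
      ... | there (there (here eq)) = contradiction (sym eq) (c≢v i j)
      T-inj : ∀ i j → T i ≡ T j → i ≡ j
      T-inj i j eq
        with v∈T⇒ j (subst (v i ∈_) eq (v∈T i)) | v∈T⇒ i (subst (v j ∈_) (sym eq) (v∈T j))
      ... | inj₁ i≡j      | _             = i≡j
      ... | inj₂ _        | inj₁ j≡i      = sym j≡i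
      -- Here each index would be the successor of the other, which a cycle of length at least three
      -- excludes.
      ... | inj₂ i≡next-j | inj₂ j≡next-i =
        contradiction (trans (cong next (sym j≡next-i)) (sym i≡next-j)) (next-next≢ 3≤m i)

      -- Any edge of the cycle would serve for the insertion; the closing one is taken so that `w`
      -- gets index zero and every other index is just shifted by one.
      last : Fin (suc m)
      last = fromℕ m
      w : Fin n
      w = c (C last)
      -- Only `T j` and `T (prev j)` contain `v j`. The heavy pair of `v j` and `w` lies in at least
      -- three edges, so one of them is neither of these two and hence no `T i` at all.
      extra : ∀ j → a (C last) ≡ v j →
              ∃[ e ] (∀ i → e ≢ T i) × e ∈ₗ edges H × v j ∈ e × w ∈ e
      extra j a≡vj
        with surplus _≟ˢ_ {ys = T j ∷ T (prev j) ∷ []} (containing-unique H (pair (v j) w))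
               (subst (λ x → 3 ≤ codegree H x w) a≡vj (heavy (C last)))
      ... | e , e∈ , e∉ with ∈-containing⁻ H e∈
      ...   | e∈H , vj∈e , w∈e = e , e≢T , e∈H , vj∈e , w∈e
        where
        e≢T : ∀ i → e ≢ T i
        e≢T i e≡T with v∈T⇒ i (subst (v j ∈_) e≡T vj∈e)
        ... | inj₁ refl = e∉ (here e≡T)
        ... | inj₂ refl = e∉ (there (here (trans e≡T (cong T (sym (prev-next i))))))

      v⁺∈T-inject₁ : ∀ i → v (suc i) ∈ T (inject₁ i)
      v⁺∈T-inject₁ i = subst (λ j → v j ∈ T (inject₁ i)) (next-inject₁ i) (v⁺∈T (inject₁ i))

      -- With the heavy pair at `v zero`, the edge `T last` joins `v last` to its own third vertex
      -- `w`, and `e` joins `w` to `v zero`.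
      insert-after : a (C last) ≡ v zero → BergeCycle (2 + m) H
      insert-after a≡v₀ with extra zero a≡v₀
      ... | e , e≢T , e∈H , v₀∈e , w∈e =
        detour v w e T v-distinct (c≢v last) (λ {i} {j} → T-inj i j) e≢T e∈H (edge ∘ C)
          w∈e v₀∈e v∈T v⁺∈T-inject₁ (c∈ (C last))

      -- With the heavy pair at `v last`, the roles are exchanged: `e` joins `v last` to `w`, and
      -- `T last` joins `w` to `v zero`. So `T last` becomes the first edge of the detour, and `g`
      -- is `T` with its last value replaced by `e`.
      insert-before : a (C last) ≡ v last → BergeCycle (2 + m) H
      insert-before a≡v with extra last a≡v
      ... | e , e≢T , e∈H , v∈e , w∈e =
        detour v w (T last) g v-distinct (c≢v last) (λ {i} {j} → g-inj i j) T≢g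
          (edge (C last)) g∈H (c∈ (C last))
          (subst (λ j → v j ∈ T last) (next-fromℕ m) (v⁺∈T last)) v∈g v⁺∈g w∈g
        where
        g : Fin (suc m) → Subset n
        g i with i ≟ᶠ last
        ... | yes _ = e
        ... | no  _ = T i
        g-inj : ∀ i j → g i ≡ g j → i ≡ j
        g-inj i j eq with i ≟ᶠ last | j ≟ᶠ last
        ... | yes i≡ | yes j≡ = trans i≡ (sym j≡)
        ... | yes _  | no  _  = contradiction eq (e≢T j)
        ... | no  _  | yes _  = contradiction (sym eq) (e≢T i)
        ... | no  _  | no  _  = T-inj i j eq
        T≢g : ∀ i → T last ≢ g i
        T≢g i eq with i ≟ᶠ last
        ... | yes _      = e≢T last (sym eq)
        ... | no  i≢last = i≢last (sym (T-inj last i eq))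
        g∈H : ∀ i → g i ∈ₗ edges H
        g∈H i with i ≟ᶠ last
        ... | yes _ = e∈H
        ... | no  _ = edge (C i)
        v∈g : ∀ i → v i ∈ g i
        v∈g i with i ≟ᶠ last
        ... | yes refl = v∈e
        ... | no  _    = v∈T i
        v⁺∈g : ∀ i → v (suc i) ∈ g (inject₁ i)
        v⁺∈g i with inject₁ i ≟ᶠ last
        ... | yes eq = contradiction (sym eq) fromℕ≢inject₁
        ... | no  _  = v⁺∈T-inject₁ i
        w∈g : w ∈ g last
        w∈g with last ≟ᶠ last
        ... | yes _   = w∈e
        ... | no  neq = contradiction refl neq

      result : BergeCycle (2 + m) H
      result with ∈pair⁻ (subst (a (C last) ∈_) (sym (pair≡ last)) (left∈pair _ _))
      ... | inj₁ a≡v  = insert-before a≡v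
      ... | inj₂ a≡v⁺ = insert-after (trans a≡v⁺ (cong v (next-fromℕ m)))

  configurations : ∀ {es} → All Configuration es →
                   ∃[ Cs ] map (proj₁ {B = Configuration}) Cs ≡ es
  configurations []       = [] , refl
  configurations (C ∷ Cs) = let Cs′ , eq = configurations Cs in
                            (_ , C) ∷ Cs′ , cong (_ ∷_) eq

  -- By `Σˢ-splits` every configuration is split by exactly a quarter of the colourings, so
  -- averaging finds one colouring that splits at least a quarter of the list. The light pairs of
  -- those configurations form the graph `G`.
  configurations-bound : ¬ BergeCycle (suc m) H → (Cs : List (∃ Configuration)) →
                         Unique (map proj₁ Cs) →
                         ∃[ G ] ¬ Cycle m G × length (map proj₁ Cs) ≤ 4 * size G
  configurations-bound free Cs Cs! with averaging (λ s (_ , C) → splits? s (a C) (b C) (c C)) 4 {Cs}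
    (All.tabulate λ { {_ , C} _ → ≤-reflexive (Σˢ-splits (distinct C)) })
  ... | s , often = lightGraph s Ds Ds-splits Ds! , free ∘ lightGraph-cycle s Ds Ds-splits Ds! , (begin
      length (map proj₁ Cs)         ≡⟨ length-map proj₁ Cs ⟩
      length Cs                     ≤⟨ often ⟩
      4 * length Ds                 ≡⟨ cong (4 *_) (length-map lightPair Ds) ⟨
      4 * length (map lightPair Ds) ∎)
    where
    open ≤-Reasoning
    split? : Decidable (λ ((_ , C) : ∃ Configuration) → Splits s (a C) (b C) (c C))
    split? (_ , C) = splits? s (a C) (b C) (c C)
    Ds : List (∃ Configuration)
    Ds = filter split? Cs
    Ds-splits : All (λ (_ , C) → Splits s (a C) (b C) (c C)) Ds
    Ds-splits = All.all-filter split? Cs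
    Ds! : Unique (map proj₁ Ds)
    Ds! = AllPairs.map⁺ (AllPairs.filter⁺ split? (AllPairs.map⁻ Cs!))

  light-part : ∀ {es} → ¬ BergeCycle (suc m) H → Unique es → All Configuration es →
               ∃[ G ] ¬ Cycle m G × length es ≤ 4 * size G
  light-part {m} free es! configs with configurations configs
  ... | Cs , eq = subst (λ es → Unique es → ∃[ G ] ¬ Cycle m G × length es ≤ 4 * size G) eq
                        (configurations-bound free Cs) es!

-- Partition of the edges and summation of the three bounds

module _ (H : Hypergraph 3 n) (free : ¬ BergeCycle (suc m) H) where

  private
    -- An edge with neither a light nor a heavy pair is put into `dark`, so that `dark`, `both` and
    -- `thin` partition the edges.
    dark lit both thin : List (Subset n)
    dark = filter (¬? ∘ light? H) (edges H)
    lit  = filter (light? H) (edges H)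
    both = filter (heavy? H) lit
    thin = filter (¬? ∘ heavy? H) lit

    lit! : Unique lit
    lit! = Unique.filter⁺ (light? H) (unique H)

    lit⁻ : ∀ {e} → e ∈ₗ lit → e ∈ₗ edges H × Light H e
    lit⁻ = ∈-filter⁻ (light? H) {xs = edges H}

  dark≤t : length dark ≤ t (suc m) n
  dark≤t = ≤-trans (dark-count H)
    (Maximum.bound (tMaximum (suc m) n) (thickGraph H) (free ∘ thickGraph-cycle H))

  both≤ex : length both ≤ 4 * ex n m
  both≤ex =
    let G , G-free , both≤ = light-part H free (Unique.filter⁺ (heavy? H) lit!)
          (All.tabulate λ e∈ →
            let e∈lit , heavy = ∈-filter⁻ (heavy? H) {xs = lit} e∈
                e∈H , light = lit⁻ e∈lit
            in configuration H e∈H light heavy)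
    in ≤-trans both≤ (*-monoʳ-≤ 4 (Maximum.bound (exMaximum n m) G G-free))

  thin≤ex₃ˡⁱⁿ : length thin ≤ 12 * ex₃ˡⁱⁿ n (suc m)
  thin≤ex₃ˡⁱⁿ =
    let K , K-linear , K⊑H , thin≤ = linear-part H (Unique.filter⁺ (¬? ∘ heavy? H) lit!)
          (All.tabulate λ e∈ →
            let e∈lit , ¬heavy = ∈-filter⁻ (¬? ∘ heavy? H) {xs = lit} e∈
            in proj₁ (lit⁻ e∈lit) , ¬heavy)
    in ≤-trans thin≤ (*-monoʳ-≤ 12
         (Maximum.bound (ex₃ˡⁱⁿMaximum n (suc m)) K (K-linear , free ∘ BergeCycle-mono K⊑H)))

  size-bound : size H ≤ t (suc m) n + 4 * ex n m + 12 * ex₃ˡⁱⁿ n (suc m)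
  size-bound = begin
    size H                                           ≡⟨ length-filter-split (light? H) (edges H) ⟩
    length lit + length dark                         ≡⟨ +-comm (length lit) (length dark) ⟩
    length dark + length lit
      ≡⟨ cong (length dark +_) (length-filter-split (heavy? H) lit) ⟩
    length dark + (length both + length thin)        ≡⟨ +-assoc (length dark) _ _ ⟨
    length dark + length both + length thin
      ≤⟨ +-mono-≤ (+-mono-≤ dark≤t both≤ex) thin≤ex₃ˡⁱⁿ ⟩
    t (suc m) n + 4 * ex n m + 12 * ex₃ˡⁱⁿ n (suc m) ∎
    where open ≤-Reasoning

ex₃-bound : ∀ n m → ex₃ n (suc m) ≤ t (suc m) n + 4 * ex n m + 12 * ex₃ˡⁱⁿ n (suc m)
ex₃-bound n m =
  let H , free , size≡ = Maximum.attained (ex₃Maximum n (suc m))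
  in ≤-trans (≤-reflexive (sym size≡)) (size-bound H free)

theorem2 : (k : ℕ) → 2 ≤ k → (n : ℕ) → 1 ≤ n →
    ex₃ n (2 * k + 1) ≤ t (2 * k + 1) n + 4 * ex n (2 * k) + 12 * ex₃ˡⁱⁿ n (2 * k + 1)
theorem2 k _ n _ =
  -- `2 * k + 1` equals `suc (2 * k)` only propositionally, so the bound is transported.
  subst (λ ℓ → ex₃ n ℓ ≤ t ℓ n + 4 * ex n (2 * k) + 12 * ex₃ˡⁱⁿ n ℓ)
        (+-comm 1 (2 * k)) (ex₃-bound n (2 * k))
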